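{- Let $\mathcal{L}=(Var,\mathcal{O},\Vvdash)$ be a many-valued logic with algebra of truth values $\mathbf{A}=(A,\sqsubseteq,\{o\}_{o\in\mathcal{O}})$, let $\mathcal{M}$ be the class of all its algebraic models, and let $\mathcal{K}_{\mathcal{M}}$ be a class of Kripke models of $\mathcal{L}$ such that $\mathcal{M}$ and $\mathcal{K}_{\mathcal{M}}$ satisfy the representation assumption given in the context, with monotone injection $i_n:A\hookrightarrow A_K=\mathcal{P}(1_K)$. Then, for $(\mathbf{A},I)\in\mathcal{M}$ and $(K,I_K)=\mathbb{D}(\mathbf{A},I)$, the injective mapping $i_n$ extends to an injective homomorphism $$i_n:(\mathbf{A},I)\hookrightarrow(\mathbf{A}_K,I_K),$$ that is, for every $o\in\mathcal{O}$ of arity $n\ge 1$ and all $x_1,\dots,x_n\in A$ we have $i_n(o(x_1,\dots,x_n))=o_K(i_n(x_1),\dots,i_n(x_n))$, and $i_n\circ I=I_K$. Thus the dual representation of the algebra $\mathbf{A}$ is the subalgebra of $\mathbf{A}_K$ defined by the image of the homomorphism $i_n$.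
   Context: **Logic and valuations.** $Var$ is a set of propositional symbols, $\mathcal{O}$ a set of connectives with arities, and $F(\mathcal{L})$ the set of formulae. The truth values form a poset $(A,\sqsubseteq)$, and each connective of arity $n\ge1$ is interpreted by a function $o:A^n\to A$, which gives the algebra $\mathbf{A}=(A,\sqsubseteq,\{o\}_{o\in\mathcal{O}})$. Every truth value $x\in A$ is also a propositional constant of the language ($A\subset Var\subseteq F(\mathcal{L})$). A valuation is a map $I:Var\to A$ with $I(x)=x$ for all $x\in A$; it extends uniquely to a homomorphism $\overline{I}:F(\mathcal{L})\to A$. A certain nonempty set of valuations is the set of models of $\mathcal{L}$ (those satisfying all the sequents that define $\mathcal{L}$). **Algebraic models.** An algebraic model of $\mathcal{L}$ is a pair $(\mathbf{A},I)$ with $I$ a model of $\mathcal{L}$. $\mathcal{M}$ is the class of all algebraic models. **Kripke models.** A Kripke model is a pair $(K,I_K)$, where $K=(1_K,\{R_j\}_{j\le n})$ is a frame with set of possible worlds $1_K$ and finitely many accessibility relations $R_j$, and $I_K:Var\to\mathcal{P}(1_K)$. Put $A_K=\mathcal{P}(1_K)$. **Representation assumption.** There are mappings $\mathbb{D}:\mathcal{M}\to\mathcal{K}_{\mathcal{M}}$, with $\mathcal{K}_{\mathcal{M}}=\{\mathbb{D}(M)\mid M=(\mathbf{A},I)\in\mathcal{M}\}$, and $\mathbb{E}:\mathcal{K}_{\mathcal{M}}\to\mathcal{M}$ such that: (i) for every $(K,I_K)\in\mathcal{K}_{\mathcal{M}}$, $\mathbb{E}((K,I_K))=(\mathbf{A}_K,I_K)$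 is an algebraic model of $\mathcal{L}$, where $\mathbf{A}_K=(\mathcal{P}(1_K),\subseteq,\{o_K\}_{o\in\mathcal{O}})$ is an algebra of subsets of $1_K$; the map $I_K$ extends to a homomorphism $\overline{I}_K:F(\mathcal{L})\to\mathbf{A}_K$ of $\mathcal{O}$-algebras; (ii) for every $M=(\mathbf{A},I)\in\mathcal{M}$, with $(K,I_K)=\mathbb{D}(M)$ and $\mathbb{E}(\mathbb{D}(M))=(\mathbf{A}_K,I_K)$, there is a monotone injection $i_n:(A,\sqsubseteq)\hookrightarrow(A_K,\subseteq)$ with $I_K=i_n\circ I$ and, for the extensions to formulae, $\overline{I}_K=i_n\circ\overline{I}$. Put $D_K=\{i_n(x)\mid x\in A\}$. It is not assumed that $i_n$ is a homomorphism. -}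

module Defs where

open import Data.Fin.Base using (Fin)
open import Data.Nat.Base using (ℕ; _≤_)
open import Data.Product.Base using (Σ; ∃; _×_; _,_; proj₁; proj₂)
open import Data.Vec.Functional using (Vector)
open import Function.Base using (_∘_; id)
open import Function.Definitions using (Injective; Surjective)
open import Level using (Level; _⊔_; suc)
open import Relation.Binary.Bundles using (Poset)
open import Relation.Binary.Morphism.Structures using (IsOrderHomomorphism)
open import Relation.Binary.PropositionalEquality.Core using (_≡_; refl)
import Relation.Binary.Construct.On as On
open import Relation.Unary using (Pred; _∈_; _⊆_; _≐_)
open import Relation.Unary.Relation.Binary.Subset using (⊆-poset)

private
  variable
    v o s t ℓ : Level
    c ℓ₁ ℓ₂ c′ ℓ₁′ ℓ₂′ : Level

record Language (v o : Level) : Set (suc (v ⊔ o)) where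
  field
    Var     : Set v
    Op      : Set o
    arity   : Op → ℕ
    arity≥1 : ∀ ⊙ → 1 ≤ arity ⊙

module _ (𝓛 : Language v o) where

  open Language 𝓛

  data Formula : Set (v ⊔ o) where
    var : Var → Formula
    op  : (⊙ : Op) → Vector Formula (arity ⊙) → Formula

  -- (A, ⊑, {o}).  Carriers are setoids: equality is the poset's own
  -- equality, so that subset algebras can use extensional equality _≐_.
  record Algebra (c ℓ₁ ℓ₂ : Level) : Set (o ⊔ suc (c ⊔ ℓ₁ ⊔ ℓ₂)) where
    field
      poset : Poset c ℓ₁ ℓ₂
    open Poset poset public using (Carrier; _≈_) renaming (_≤_ to _⊑_)
    field
      ⟦_⟧    : (⊙ : Op) → Vector Carrier (arity ⊙) → Carrier
      ⟦⟧-cong : ∀ ⊙ {xs ys : Vector Carrier (arity ⊙)} →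
                (∀ i → xs i ≈ ys i) → ⟦ ⊙ ⟧ xs ≈ ⟦ ⊙ ⟧ ys

  extend : (𝐁 : Algebra c ℓ₁ ℓ₂) →
           (Var → Algebra.Carrier 𝐁) → Formula → Algebra.Carrier 𝐁
  extend 𝐁 I (var p)    = I p
  extend 𝐁 I (op ⊙ φs) = Algebra.⟦_⟧ 𝐁 ⊙ (λ i → extend 𝐁 I (φs i))

module _ {𝓛 : Language v o}
         (𝐁 : Algebra 𝓛 c ℓ₁ ℓ₂) (𝐂 : Algebra 𝓛 c′ ℓ₁′ ℓ₂′)
         where

  private
    module L = Language 𝓛
    module B = Algebra 𝐁
    module C = Algebra 𝐂

  -- Only monotonicity is required for the order; it need not be reflected.
  record IsHomomorphism (f : B.Carrier → C.Carrier)
                        : Set (o ⊔ c ⊔ ℓ₁ ⊔ ℓ₂ ⊔ c′ ⊔ ℓ₁′ ⊔ ℓ₂′) where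
    field
      isOrderHomomorphism : IsOrderHomomorphism B._≈_ C._≈_ B._⊑_ C._⊑_ f
      homo : ∀ ⊙ (xs : Vector B.Carrier (L.arity ⊙)) →
             f (B.⟦ ⊙ ⟧ xs) C.≈ C.⟦ ⊙ ⟧ (f ∘ xs)

  record IsInjectiveHomomorphism (f : B.Carrier → C.Carrier)
                        : Set (o ⊔ c ⊔ ℓ₁ ⊔ ℓ₂ ⊔ c′ ⊔ ℓ₁′ ⊔ ℓ₂′) where
    field
      isHomomorphism : IsHomomorphism f
      injective      : Injective B._≈_ C._≈_ f

  record IsBijectiveHomomorphism (f : B.Carrier → C.Carrier)
                        : Set (o ⊔ c ⊔ ℓ₁ ⊔ ℓ₂ ⊔ c′ ⊔ ℓ₁′ ⊔ ℓ₂′) where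
    field
      isInjectiveHomomorphism : IsInjectiveHomomorphism f
      surjective              : Surjective B._≈_ C._≈_ f

module _ {𝓛 : Language v o} (𝐁 : Algebra 𝓛 c ℓ₁ ℓ₂)
         (D : Pred (Algebra.Carrier 𝐁) ℓ)
         where

  open Language 𝓛
  open Algebra 𝐁

  IsSubuniverse : Set (o ⊔ c ⊔ ℓ)
  IsSubuniverse = ∀ ⊙ (xs : Vector Carrier (arity ⊙)) →
                  (∀ i → xs i ∈ D) → ⟦ ⊙ ⟧ xs ∈ D

  subalgebra : IsSubuniverse → Algebra 𝓛 (c ⊔ ℓ) ℓ₁ ℓ₂
  subalgebra closed = record
    { poset   = On.poset {B = Σ Carrier D} poset proj₁
    ; ⟦_⟧     = λ ⊙ xs → ⟦ ⊙ ⟧ (proj₁ ∘ xs) , closed ⊙ (proj₁ ∘ xs) (proj₂ ∘ xs)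
    ; ⟦⟧-cong = λ ⊙ → ⟦⟧-cong ⊙
    }

-- The carrier of truth values has the size of a power set Pred W ℓ with
-- W : Set ℓ, so that one satisfaction relation covers both the truth values
-- and the algebras of subsets.
record ManyValuedLogic (v o s t ℓ : Level) : Set (suc (v ⊔ o ⊔ s ⊔ t ⊔ suc ℓ)) where
  field
    language : Language v o
  open Language language public
  field
    𝐀 : Algebra language (suc ℓ) ℓ ℓ
  open Algebra 𝐀 public using () renaming (Carrier to A; _≈_ to _≈ᴬ_; _⊑_ to _⊑ᴬ_)
  field
    -- A ⊂ Var
    const           : A → Var
    const-injective : Injective _≈ᴬ_ _≡_ const

    -- The shape of sequents and their satisfaction are left arbitrary;
    -- s ∈ ⊩ says that s is one of the sequents defining the logic.
    Sequent : Set s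
    ⊩       : Pred Sequent s
    _,_⊨_   : (𝐁 : Algebra language (suc ℓ) ℓ ℓ) →
              (Var → Algebra.Carrier 𝐁) → Sequent → Set t

  IsValuation : (Var → A) → Set (suc ℓ)
  IsValuation I = ∀ x → I (const x) ≈ᴬ x

  SatisfiesSequents : (𝐁 : Algebra language (suc ℓ) ℓ ℓ) →
                      (Var → Algebra.Carrier 𝐁) → Set (s ⊔ t)
  SatisfiesSequents 𝐁 I = ∀ {σ} → σ ∈ ⊩ → 𝐁 , I ⊨ σ

  field
    models-nonempty : ∃ λ (I : Var → A) → IsValuation I × SatisfiesSequents 𝐀 I

module _ (L : ManyValuedLogic v o s t ℓ) where

  open ManyValuedLogic L

  -- A pair (𝐁 , I) with 𝐁 any algebra of the language.
  record AlgebraicModel : Set (v ⊔ o ⊔ s ⊔ t ⊔ suc (suc ℓ)) where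
    field
      algebra   : Algebra language (suc ℓ) ℓ ℓ
      interp    : Var → Algebra.Carrier algebra
      satisfies : SatisfiesSequents algebra interp

  -- The models (𝐀 , I) over the truth values, where I is a valuation.
  record ℳ : Set (v ⊔ s ⊔ t ⊔ suc ℓ) where
    field
      I           : Var → A
      isValuation : IsValuation I
      satisfies   : SatisfiesSequents 𝐀 I

  toAlgebraicModel : ℳ → AlgebraicModel
  toAlgebraicModel M = record
    { algebra = 𝐀 ; interp = ℳ.I M ; satisfies = ℳ.satisfies M }

  record IsModelEmbedding (M N : AlgebraicModel)
      (f : Algebra.Carrier (AlgebraicModel.algebra M) →
           Algebra.Carrier (AlgebraicModel.algebra N))
      : Set (v ⊔ o ⊔ suc ℓ) where
    private
      module M = AlgebraicModel M
      module N = AlgebraicModel N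
    field
      isInjectiveHomomorphism : IsInjectiveHomomorphism M.algebra N.algebra f
      preserves-interp        : ∀ p → Algebra._≈_ N.algebra (f (M.interp p)) (N.interp p)

-- Accessibility relations may have any finite arity (binary: relArity j = 2;
-- an n-ary modality uses an (n+1)-ary relation).
record Frame (ℓ : Level) : Set (suc ℓ) where
  field
    World     : Set ℓ
    relations : ℕ
    relArity  : Fin relations → ℕ
    R         : ∀ j → Pred (Vector World (relArity j)) ℓ

record KripkeModel (Var : Set v) (ℓ : Level) : Set (v ⊔ suc ℓ) where
  field
    frame : Frame ℓ
  open Frame frame public
  field
    I_K : Var → Pred World ℓ

record SubsetOperations (𝓛 : Language v o) (W : Set ℓ) : Set (o ⊔ suc ℓ) where
  open Language 𝓛
  field
    ⟦_⟧    : (⊙ : Op) → Vector (Pred W ℓ) (arity ⊙) → Pred W ℓ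
    ⟦⟧-cong : ∀ ⊙ {Xs Ys : Vector (Pred W ℓ) (arity ⊙)} →
              (∀ i → Xs i ≐ Ys i) → ⟦ ⊙ ⟧ Xs ≐ ⟦ ⊙ ⟧ Ys

subsetAlgebra : {𝓛 : Language v o} {W : Set ℓ} →
                SubsetOperations 𝓛 W → Algebra 𝓛 (suc ℓ) ℓ ℓ
subsetAlgebra {ℓ = ℓ} {W = W} ops = record
  { poset   = ⊆-poset W ℓ
  ; ⟦_⟧     = SubsetOperations.⟦_⟧ ops
  ; ⟦⟧-cong = SubsetOperations.⟦⟧-cong ops
  }

record Representation (L : ManyValuedLogic v o s t ℓ)
    : Set (v ⊔ o ⊔ s ⊔ t ⊔ suc ℓ) where
  open ManyValuedLogic L
  open KripkeModel using (World; I_K)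

  field
    𝔻 : ℳ L → KripkeModel Var ℓ

  𝒦_ℳ : Pred (KripkeModel Var ℓ) (v ⊔ s ⊔ t ⊔ suc ℓ)
  𝒦_ℳ k = ∃ λ M → 𝔻 M ≡ k

  field
    -- Membership in 𝒦_ℳ is irrelevant here: the operations o_K depend on
    -- the Kripke model alone, not on the M that it represents.
    operations : (k : KripkeModel Var ℓ) → .(k ∈ 𝒦_ℳ) → SubsetOperations language (World k)

  𝐀_K : (k : KripkeModel Var ℓ) → .(k ∈ 𝒦_ℳ) → Algebra language (suc ℓ) ℓ ℓ
  𝐀_K k k∈ = subsetAlgebra (operations k k∈)

  field
    satisfies-K : ∀ k (k∈ : k ∈ 𝒦_ℳ) → SatisfiesSequents (𝐀_K k k∈) (I_K k)

  𝔼 : (k : KripkeModel Var ℓ) → k ∈ 𝒦_ℳ → AlgebraicModel L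
  𝔼 k k∈ = record
    { algebra = 𝐀_K k k∈ ; interp = I_K k ; satisfies = satisfies-K k k∈ }

  𝔻∈𝒦 : ∀ M → 𝔻 M ∈ 𝒦_ℳ
  𝔻∈𝒦 M = M , refl

  field
    iₙ : (M : ℳ L) → A → Pred (World (𝔻 M)) ℓ
    iₙ-monotone  : ∀ M → IsOrderHomomorphism _≈ᴬ_ _≐_ _⊑ᴬ_ _⊆_ (iₙ M)
    iₙ-injective : ∀ M → Injective _≈ᴬ_ _≐_ (iₙ M)
    I_K≐iₙ∘I     : ∀ M p → I_K (𝔻 M) p ≐ iₙ M (ℳ.I M p)
    Ī_K≐iₙ∘Ī     : ∀ M φ → extend language (𝐀_K (𝔻 M) (𝔻∈𝒦 M)) (I_K (𝔻 M)) φ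
                            ≐ iₙ M (extend language 𝐀 (ℳ.I M) φ)

  D_K : (M : ℳ L) → Pred (Pred (World (𝔻 M)) ℓ) (suc ℓ)
  D_K M S = ∃ λ x → iₙ M x ≐ S

  iₙ-onto-image : (M : ℳ L) → A → Σ (Pred (World (𝔻 M)) ℓ) (D_K M)
  iₙ-onto-image M x = iₙ M x , x , id , id

{-# OPTIONS --safe #-}
-- Every truth value x is a propositional constant with I x = x, so
-- o(x₁,…,xₙ) is the value under Ī of the formula o(x₁,…,xₙ).  Since
-- Ī_K = iₙ ∘ Ī and Ī_K commutes with the connectives, evaluating this formula
-- in both algebras shows that iₙ commutes with o.
module Submission where

open import Defs
open import Data.Product.Base using (_×_; Σ-syntax; ∃; _,_; proj₁; proj₂; swap)
open import Data.Vec.Functional using (Vector)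
open import Function.Base using (_∘_)
open import Level using (Level)
open import Relation.Binary.Bundles using (Poset)
open import Relation.Binary.Morphism.Structures using (IsOrderHomomorphism)
import Relation.Binary.Reasoning.Setoid as ≈-Reasoning
open import Relation.Unary using (Pred; _≐_)

private
  variable
    v o s t ℓ : Level
    c ℓ₁ ℓ₂ c′ ℓ₁′ ℓ₂′ : Level

module _ {𝓛 : Language v o}
         {𝐁 : Algebra 𝓛 c ℓ₁ ℓ₂} {𝐂 : Algebra 𝓛 c′ ℓ₁′ ℓ₂′}
         {f : Algebra.Carrier 𝐁 → Algebra.Carrier 𝐂}
         where

  private
    module B = Algebra 𝐁
    module C where
      open Algebra 𝐂 public
      open Poset poset public using (module Eq)

  -- At `f = iₙ M` this unfolds to `D_K M`, so the results on images below apply to `D_K M` without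
  -- conversion.
  Image : Pred C.Carrier _
  Image y = ∃ λ x → f x C.≈ y

  image-isSubuniverse : IsHomomorphism 𝐁 𝐂 f → IsSubuniverse 𝐂 Image
  image-isSubuniverse f-hom ⊙ ys ys∈ =
    -- Each membership proof carries a preimage, so no choice is made.
    B.⟦ ⊙ ⟧ (proj₁ ∘ ys∈) ,
    C.Eq.trans (IsHomomorphism.homo f-hom ⊙ (proj₁ ∘ ys∈))
               (C.⟦⟧-cong ⊙ (proj₂ ∘ ys∈))

  -- Equality and order of the subalgebra are those of `𝐂` pulled back along `proj₁`, so the laws of
  -- `f` carry over verbatim; the membership proof of an element supplies surjectivity.
  corestriction-isBijectiveHomomorphism :
    (f-inj : IsInjectiveHomomorphism 𝐁 𝐂 f) →
    IsBijectiveHomomorphism 𝐁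
      (subalgebra 𝐂 Image
        (image-isSubuniverse (IsInjectiveHomomorphism.isHomomorphism f-inj)))
      (λ x → f x , x , C.Eq.refl)
  corestriction-isBijectiveHomomorphism f-inj = record
    { isInjectiveHomomorphism = record
      { isHomomorphism = record
        { isOrderHomomorphism = record { cong = cong ; mono = mono }
        ; homo                = homo
        }
      ; injective = injective
      }
    ; surjective = λ (_ , x , fx≈y) → x , λ z≈x → C.Eq.trans (cong z≈x) fx≈y
    }
    where
    open IsInjectiveHomomorphism f-inj
    open IsHomomorphism isHomomorphism
    open IsOrderHomomorphism isOrderHomomorphism

module _ (L : ManyValuedLogic v o s t ℓ) (Rep : Representation L) where

  open ManyValuedLogic L
  open Representation Rep

  module _ (M : ℳ L) where

    open ℳ M

    private
      𝐊 = 𝐀_K (𝔻 M) (𝔻∈𝒦 M)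
      module A where
        open Algebra 𝐀 public
        open Poset poset public using (module Eq)
      module K where
        open Algebra 𝐊 public
        open Poset poset public using (module Eq)

    open IsOrderHomomorphism (iₙ-monotone M) using () renaming (cong to iₙ-cong)

    -- Since `I` fixes constants, `const x` names `x` in `𝐀` and also its image in `𝐊`.
    iₙ-const : ∀ x → iₙ M x ≐ KripkeModel.I_K (𝔻 M) (const x)
    iₙ-const x = K.Eq.trans (iₙ-cong (A.Eq.sym (isValuation x)))
                            (K.Eq.sym (I_K≐iₙ∘I M (const x)))

    iₙ-homo : ∀ ⊙ (xs : Vector A (arity ⊙)) →
              iₙ M (A.⟦ ⊙ ⟧ xs) ≐ K.⟦ ⊙ ⟧ (iₙ M ∘ xs)
    iₙ-homo ⊙ xs = begin
      iₙ M (A.⟦ ⊙ ⟧ xs)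
        ≈⟨ iₙ-cong (A.⟦⟧-cong ⊙ (isValuation ∘ xs)) ⟨
      iₙ M (extend language 𝐀 I φ)
        -- The passage between the two algebras: the assumption on compound formulae moves `⊙` from
        -- inside `iₙ M` to outside.
        ≈⟨ Ī_K≐iₙ∘Ī M φ ⟨
      extend language 𝐊 (KripkeModel.I_K (𝔻 M)) φ
        ≈⟨ K.⟦⟧-cong ⊙ (iₙ-const ∘ xs) ⟨
      K.⟦ ⊙ ⟧ (iₙ M ∘ xs)
        ∎
      where
      open ≈-Reasoning (Poset.Eq.setoid K.poset)
      φ : Formula language
      φ = op ⊙ (var ∘ const ∘ xs)

    iₙ-isInjectiveHomomorphism : IsInjectiveHomomorphism 𝐀 𝐊 (iₙ M)
    iₙ-isInjectiveHomomorphism = record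
      { isHomomorphism = record
        { isOrderHomomorphism = iₙ-monotone M
        ; homo                = iₙ-homo
        }
      ; injective = iₙ-injective M
      }

theorem3 : ∀ {v o s t ℓ} (L : ManyValuedLogic v o s t ℓ) (Rep : Representation L) →
    let open ManyValuedLogic L
        open Representation Rep
    in (M : ℳ L) →
       IsModelEmbedding L (toAlgebraicModel L M) (𝔼 (𝔻 M) (𝔻∈𝒦 M)) (iₙ M)
       × (Σ[ closed ∈ IsSubuniverse (𝐀_K (𝔻 M) (𝔻∈𝒦 M)) (D_K M) ]
            IsBijectiveHomomorphism 𝐀
              (subalgebra (𝐀_K (𝔻 M) (𝔻∈𝒦 M)) (D_K M) closed)
              (iₙ-onto-image M))
theorem3 L Rep M =
  record
    { isInjectiveHomomorphism = iₙ-inj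
    -- An extensional equality is a pair of inclusions, so `swap` is its symmetry.
    ; preserves-interp        = λ p → swap (Representation.I_K≐iₙ∘I Rep M p)
    } ,
  image-isSubuniverse (IsInjectiveHomomorphism.isHomomorphism iₙ-inj) ,
  -- Reflexivity of `≐` computes to `id , id`, so the corestricted map is `iₙ-onto-image M`.
  corestriction-isBijectiveHomomorphism iₙ-inj
  where
  iₙ-inj = iₙ-isInjectiveHomomorphism L Rep M
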